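{- Let $p\ge 1$ and $k\ge 0$ be integers. Consider the system of $p^2$ linear equations in $p^2$ unknowns $F(a,b)\in\mathbb{R}[[x]]$, indexed by $(a,b)\in[p]\times[p]$, $$F(a,b)=x\left(\sum_{i\in[p],\ i\le k+2b-a}F(b,i)\right)+x^2 .$$ This system has a unique solution in $\mathbb{R}[[x]]$, and the solution is $F(a,b)=\sum_{n\ge 2}f_n(a,b)x^n$. Consequently the generating function by length of the locally convex words on $[p]$ with parameter $k$ (words of length $0$ and $1$ included) is $$G_{k,p}=1+px+\sum_{a,b\in[p]}F(a,b).$$
   Context: $[n]=\{1,2,\ldots,n\}$. A word of length $n$ on the alphabet $[p]$ is a function $f:[n]\to[p]$; it is locally convex with parameter $k$ if $f(i-1)+f(i+1)-2f(i)\le k$ for all $i\in\{2,\ldots,n-1\}$ (a vacuous condition for $n\le 2$). For $n\ge 2$ and $a,b\in[p]$, $f_n(a,b)$ denotes the number of locally convex words $f:[n]\to[p]$ with parameter $k$ such that $f(1)=a$ and $f(2)=b$. $\mathbb{R}[[x]]$ is the ring of formal power series. -}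

module Defs where

open import Algebra.Bundles using (CommutativeRing; RawRing; Semiring)
open import Algebra.Structures using (IsMagma; IsMonoid; IsAbelianGroup; IsRing; IsCommutativeRing)
import Algebra.Definitions.RawSemiring as RawSemiringDefinitions
open import Data.Fin.Base using (Fin; zero; suc; toℕ; finToFun)
import Data.Fin.Properties as Fin
open import Data.Integer.Base as ℤ using (ℤ; +_)
import Data.Integer.Properties as ℤ
open import Data.List.Base using (List; allFin; filter; foldr; length; map)
open import Data.Nat.Base as ℕ using (ℕ; zero; suc; _∸_; _⊔_)
import Data.Nat.Properties as ℕ
open import Data.Product.Base using (_×_; _,_; Σ-syntax)
open import Data.Rational.Base as ℚ using (ℚ; 0ℚ; 1ℚ; ½; ∣_∣; Positive; positive)
import Data.Rational.Properties as ℚ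
open import Data.Rational.Solver using (module +-*-Solver)
open import Level using (0ℓ)
open import Relation.Binary.Structures using (IsEquivalence)
open import Relation.Binary.PropositionalEquality
  using (_≡_; refl; sym; trans; cong; cong₂; subst)
open import Relation.Nullary.Decidable using (_×-dec_; _→-dec_)
open import Relation.Unary using (Decidable)

-- ℝ is the ring of Cauchy sequences of rationals, with two sequences
-- identified (by the setoid equality _≃_) when their difference tends
-- to 0.

Cauchy : (ℕ → ℚ) → Set
Cauchy u = ∀ ε → 0ℚ ℚ.< ε →
  Σ[ N ∈ ℕ ] (∀ m n → N ℕ.≤ m → N ℕ.≤ n → ∣ u m ℚ.- u n ∣ ℚ.< ε)

-- Without eta, the ring operations on ℝ do not unfold during unification.
record ℝ : Set where
  no-eta-equality
  constructor mkℝ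
  field
    seq    : ℕ → ℚ
    cauchy : Cauchy seq

open ℝ public

infix 4 _≃_

record _≃_ (x y : ℝ) : Set where
  constructor mk≃
  field
    tendsTo0 : ∀ ε → 0ℚ ℚ.< ε →
      Σ[ N ∈ ℕ ] (∀ n → N ℕ.≤ n → ∣ seq x n ℚ.- seq y n ∣ ℚ.< ε)

open _≃_ public

private
  abstract
    half : ∀ {ε} → 0ℚ ℚ.< ε → 0ℚ ℚ.< ½ ℚ.* ε
    half {ε} ε>0 = ℚ.positive⁻¹ (½ ℚ.* ε) {{ℚ.pos*pos⇒pos ½ ε {{positive ε>0}}}}

    half+half : ∀ ε → ½ ℚ.* ε ℚ.+ ½ ℚ.* ε ≡ ε
    half+half ε = trans (sym (ℚ.*-distribʳ-+ ε ½ ½)) (ℚ.*-identityˡ ε)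

    divide : ∀ {ε} B → 0ℚ ℚ.< ε → 0ℚ ℚ.< B → Σ[ δ ∈ ℚ ] (0ℚ ℚ.< δ × δ ℚ.* B ≡ ε)
    divide {ε} B ε>0 B>0 = divide′ ε B {{positive ε>0}} {{positive B>0}}
      where
      divide″ : ∀ ε B .{{_ : Positive ε}} .{{_ : Positive B}}
                .{{nz : ℚ.NonZero B}} → Positive (ℚ.1/ B) → Σ[ δ ∈ ℚ ] (0ℚ ℚ.< δ × δ ℚ.* B ≡ ε)
      divide″ ε B 1/B>0 = ε ℚ.* ℚ.1/ B
        , ℚ.positive⁻¹ (ε ℚ.* ℚ.1/ B) {{ℚ.pos*pos⇒pos ε (ℚ.1/ B) {{1/B>0}}}}
        , trans (ℚ.*-assoc ε (ℚ.1/ B) B)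
            (trans (cong (ε ℚ.*_) (ℚ.*-inverseˡ B)) (ℚ.*-identityʳ ε))
      divide′ : ∀ ε B .{{_ : Positive ε}} .{{_ : Positive B}} →
                Σ[ δ ∈ ℚ ] (0ℚ ℚ.< δ × δ ℚ.* B ≡ ε)
      divide′ ε B = divide″ ε B {{nz = ℚ.pos⇒nonZero B}} (ℚ.1/pos⇒pos B)

    ∣p-p∣<ε : ∀ {p q ε} → p ≡ q → 0ℚ ℚ.< ε → ∣ p ℚ.- q ∣ ℚ.< ε
    ∣p-p∣<ε {p} refl ε>0 = subst (λ z → ∣ z ∣ ℚ.< _) (sym (ℚ.+-inverseʳ p)) ε>0

    ∣-∣-sym : ∀ p q → ∣ p ℚ.- q ∣ ≡ ∣ q ℚ.- p ∣
    ∣-∣-sym p q = trans (sym (ℚ.∣-p∣≡∣p∣ (p ℚ.- q))) (cong ∣_∣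
      (solve 2 (λ a b → :- (a :- b) := b :- a) refl p q))
      where open +-*-Solver

    +-close : ∀ a b c d {ε} → ∣ a ℚ.- c ∣ ℚ.< ½ ℚ.* ε → ∣ b ℚ.- d ∣ ℚ.< ½ ℚ.* ε →
              ∣ (a ℚ.+ b) ℚ.- (c ℚ.+ d) ∣ ℚ.< ε
    +-close a b c d {ε} ac bd = begin-strict
      ∣ (a ℚ.+ b) ℚ.- (c ℚ.+ d) ∣  ≡⟨ cong ∣_∣ (solve 4 (λ a b c d →
        (a :+ b) :- (c :+ d) := (a :- c) :+ (b :- d)) refl a b c d) ⟩
      ∣ (a ℚ.- c) ℚ.+ (b ℚ.- d) ∣  ≤⟨ ℚ.∣p+q∣≤∣p∣+∣q∣ (a ℚ.- c) (b ℚ.- d) ⟩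
      ∣ a ℚ.- c ∣ ℚ.+ ∣ b ℚ.- d ∣  <⟨ ℚ.+-mono-< ac bd ⟩
      ½ ℚ.* ε ℚ.+ ½ ℚ.* ε          ≡⟨ half+half ε ⟩
      ε                            ∎
      where open ℚ.≤-Reasoning
            open +-*-Solver

    triangle : ∀ a b c {ε} → ∣ a ℚ.- b ∣ ℚ.< ½ ℚ.* ε → ∣ b ℚ.- c ∣ ℚ.< ½ ℚ.* ε →
               ∣ a ℚ.- c ∣ ℚ.< ε
    triangle a b c {ε} ab bc = subst (λ z → ∣ z ∣ ℚ.< ε)
      (solve 3 (λ a b c → (a :+ b) :- (b :+ c) := a :- c) refl a b c)
      (+-close a b b c ab bc)
      where open +-*-Solver

    -‿close : ∀ a b {ε} → ∣ a ℚ.- b ∣ ℚ.< ε → ∣ ℚ.- a ℚ.- (ℚ.- b) ∣ ℚ.< ε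
    -‿close a b {ε} ab = subst (ℚ._< ε)
      (trans (∣-∣-sym a b) (cong ∣_∣
        (solve 2 (λ a b → b :- a := :- a :- (:- b)) refl a b))) ab
      where open +-*-Solver

    *-close : ∀ a b c d {ε} B C (B>0 : 0ℚ ℚ.< B) (C>0 : 0ℚ ℚ.< C) {δ η} →
              δ ℚ.* B ≡ ½ ℚ.* ε → η ℚ.* C ≡ ½ ℚ.* ε →
              ∣ b ∣ ℚ.≤ B → ∣ c ∣ ℚ.≤ C →
              ∣ a ℚ.- c ∣ ℚ.< δ → ∣ b ℚ.- d ∣ ℚ.< η →
              ∣ a ℚ.* b ℚ.- c ℚ.* d ∣ ℚ.< ε
    *-close a b c d {ε} B C B>0 C>0 {δ} {η} δB ηC bB cC ac bd = begin-strict
      ∣ a ℚ.* b ℚ.- c ℚ.* d ∣  ≡⟨ cong ∣_∣ (solve 4 (λ a b c d →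
        a :* b :- c :* d := (a :- c) :* b :+ (b :- d) :* c) refl a b c d) ⟩
      ∣ (a ℚ.- c) ℚ.* b ℚ.+ (b ℚ.- d) ℚ.* c ∣
        ≤⟨ ℚ.∣p+q∣≤∣p∣+∣q∣ ((a ℚ.- c) ℚ.* b) ((b ℚ.- d) ℚ.* c) ⟩
      ∣ (a ℚ.- c) ℚ.* b ∣ ℚ.+ ∣ (b ℚ.- d) ℚ.* c ∣
        <⟨ ℚ.+-mono-< (product-< (a ℚ.- c) b B B>0 ac bB)
                      (product-< (b ℚ.- d) c C C>0 bd cC) ⟩
      δ ℚ.* B ℚ.+ η ℚ.* C      ≡⟨ cong₂ ℚ._+_ δB ηC ⟩
      ½ ℚ.* ε ℚ.+ ½ ℚ.* ε      ≡⟨ half+half ε ⟩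
      ε                        ∎
      where
      open ℚ.≤-Reasoning
      open +-*-Solver
      product-< : ∀ u v V → 0ℚ ℚ.< V → ∀ {δ} → ∣ u ∣ ℚ.< δ → ∣ v ∣ ℚ.≤ V →
                  ∣ u ℚ.* v ∣ ℚ.< δ ℚ.* V
      product-< u v V V>0 {δ} u<δ v≤V = begin-strict
        ∣ u ℚ.* v ∣        ≡⟨ ℚ.∣p*q∣≡∣p∣*∣q∣ u v ⟩
        ∣ u ∣ ℚ.* ∣ v ∣    ≤⟨ ℚ.*-monoˡ-≤-nonNeg ∣ u ∣ {{ℚ.∣-∣-nonNeg u}} v≤V ⟩
        ∣ u ∣ ℚ.* V        <⟨ ℚ.*-monoˡ-<-pos V {{positive V>0}} u<δ ⟩
        δ ℚ.* V            ∎

    bound : ∀ x → Σ[ B ∈ ℚ ] (0ℚ ℚ.< B × Σ[ N ∈ ℕ ] (∀ n → N ℕ.≤ n → ∣ seq x n ∣ ℚ.≤ B))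
    bound x with cauchy x 1ℚ (ℚ.positive⁻¹ 1ℚ)
    ... | N , close = 1ℚ ℚ.+ ∣ seq x N ∣ , B>0 , N , bounded
      where
      open ℚ.≤-Reasoning
      open +-*-Solver
      B>0 : 0ℚ ℚ.< 1ℚ ℚ.+ ∣ seq x N ∣
      B>0 = ℚ.+-mono-<-≤ (ℚ.positive⁻¹ 1ℚ) (ℚ.0≤∣p∣ (seq x N))
      bounded : ∀ n → N ℕ.≤ n → ∣ seq x n ∣ ℚ.≤ 1ℚ ℚ.+ ∣ seq x N ∣
      bounded n N≤n = begin
        ∣ seq x n ∣                                ≡⟨ cong ∣_∣
          (solve 2 (λ a b → a := (a :- b) :+ b) refl (seq x n) (seq x N)) ⟩
        ∣ (seq x n ℚ.- seq x N) ℚ.+ seq x N ∣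
          ≤⟨ ℚ.∣p+q∣≤∣p∣+∣q∣ (seq x n ℚ.- seq x N) (seq x N) ⟩
        ∣ seq x n ℚ.- seq x N ∣ ℚ.+ ∣ seq x N ∣
          ≤⟨ ℚ.+-monoˡ-≤ ∣ seq x N ∣ (ℚ.<⇒≤ (close n N N≤n ℕ.≤-refl)) ⟩
        1ℚ ℚ.+ ∣ seq x N ∣                         ∎

    ⊔ˡ : ∀ l m {n} → l ⊔ m ℕ.≤ n → l ℕ.≤ n
    ⊔ˡ l m = ℕ.m⊔n≤o⇒m≤o l m

    ⊔ʳ : ∀ l m {n} → l ⊔ m ℕ.≤ n → m ℕ.≤ n
    ⊔ʳ l m = ℕ.m⊔n≤o⇒n≤o l m

    ⊔⁴ : ∀ k l m n {o} → (k ⊔ l) ⊔ (m ⊔ n) ℕ.≤ o → k ℕ.≤ o × l ℕ.≤ o × m ℕ.≤ o × n ℕ.≤ o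
    ⊔⁴ k l m n h =
      let kl = ⊔ˡ (k ⊔ l) (m ⊔ n) h
          mn = ⊔ʳ (k ⊔ l) (m ⊔ n) h
      in ⊔ˡ k l kl , ⊔ʳ k l kl , ⊔ˡ m n mn , ⊔ʳ m n mn

    +-cauchy : ∀ x y → Cauchy (λ n → seq x n ℚ.+ seq y n)
    +-cauchy x y ε ε>0 =
      let M , p = cauchy x _ (half ε>0)
          N , q = cauchy y _ (half ε>0)
      in M ⊔ N , λ m n h i →
        +-close (seq x m) (seq y m) (seq x n) (seq y n)
          (p m n (⊔ˡ M N h) (⊔ˡ M N i)) (q m n (⊔ʳ M N h) (⊔ʳ M N i))

    *-cauchy : ∀ x y → Cauchy (λ n → seq x n ℚ.* seq y n)
    *-cauchy x y ε ε>0 =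
      let C , C>0 , K , ∣x∣≤C = bound x
          B , B>0 , L , ∣y∣≤B = bound y
          δ , δ>0 , δB = divide B (half ε>0) B>0
          η , η>0 , ηC = divide C (half ε>0) C>0
          M , p = cauchy x δ δ>0
          N , q = cauchy y η η>0
      in (K ⊔ L) ⊔ (M ⊔ N) , λ m n h i →
        let _   , L≤m , M≤m , N≤m = ⊔⁴ K L M N h
            K≤n , _   , M≤n , N≤n = ⊔⁴ K L M N i
        in *-close (seq x m) (seq y m) (seq x n) (seq y n) B C B>0 C>0 δB ηC
             (∣y∣≤B m L≤m) (∣x∣≤C n K≤n) (p m n M≤m M≤n) (q m n N≤m N≤n)

    -‿cauchy : ∀ x → Cauchy (λ n → ℚ.- seq x n)
    -‿cauchy x ε ε>0 = let N , p = cauchy x ε ε>0 in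
      N , λ m n h i → -‿close (seq x m) (seq x n) (p m n h i)

    const-cauchy : ∀ q → Cauchy (λ _ → q)
    const-cauchy q ε ε>0 = 0 , λ _ _ _ _ → ∣p-p∣<ε {q} refl ε>0

infixl 6 _+ℝ_
infixl 7 _*ℝ_

fromℚ : ℚ → ℝ
seq    (fromℚ q) _ = q
cauchy (fromℚ q)   = const-cauchy q

_+ℝ_ : ℝ → ℝ → ℝ
seq    (x +ℝ y) n = seq x n ℚ.+ seq y n
cauchy (x +ℝ y)   = +-cauchy x y

_*ℝ_ : ℝ → ℝ → ℝ
seq    (x *ℝ y) n = seq x n ℚ.* seq y n
cauchy (x *ℝ y)   = *-cauchy x y

-ℝ_ : ℝ → ℝ
seq    (-ℝ x) n = ℚ.- seq x n
cauchy (-ℝ x)   = -‿cauchy x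

private
  abstract
    pointwise : ∀ {x y} → (∀ n → seq x n ≡ seq y n) → x ≃ y
    pointwise x≡y = mk≃ λ ε ε>0 → 0 , λ n _ → ∣p-p∣<ε (x≡y n) ε>0

    ≃-sym : ∀ {x y} → x ≃ y → y ≃ x
    ≃-sym {x} {y} (mk≃ f) = mk≃ λ ε ε>0 → let N , p = f ε ε>0 in
      N , λ n h → subst (ℚ._< ε) (∣-∣-sym (seq x n) (seq y n)) (p n h)

    ≃-trans : ∀ {x y z} → x ≃ y → y ≃ z → x ≃ z
    ≃-trans {x} {y} {z} (mk≃ f) (mk≃ g) = mk≃ λ ε ε>0 →
      let M , p = f _ (half ε>0)
          N , q = g _ (half ε>0)
      in M ⊔ N , λ n h → triangle (seq x n) (seq y n) (seq z n) (p n (⊔ˡ M N h)) (q n (⊔ʳ M N h))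

    +ℝ-cong : ∀ {x x′ y y′} → x ≃ x′ → y ≃ y′ → x +ℝ y ≃ x′ +ℝ y′
    +ℝ-cong {x} {x′} {y} {y′} (mk≃ f) (mk≃ g) = mk≃ λ ε ε>0 →
      let M , p = f _ (half ε>0)
          N , q = g _ (half ε>0)
      in M ⊔ N , λ n h →
        +-close (seq x n) (seq y n) (seq x′ n) (seq y′ n) (p n (⊔ˡ M N h)) (q n (⊔ʳ M N h))

    *ℝ-cong : ∀ {x x′ y y′} → x ≃ x′ → y ≃ y′ → x *ℝ y ≃ x′ *ℝ y′
    *ℝ-cong {x} {x′} {y} {y′} (mk≃ f) (mk≃ g) = mk≃ λ ε ε>0 →
      let C , C>0 , K , ∣x′∣≤C = bound x′
          B , B>0 , L , ∣y∣≤B  = bound y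
          δ , δ>0 , δB = divide B (half ε>0) B>0
          η , η>0 , ηC = divide C (half ε>0) C>0
          M , p = f δ δ>0
          N , q = g η η>0
      in (K ⊔ L) ⊔ (M ⊔ N) , λ n h →
        let K≤n , L≤n , M≤n , N≤n = ⊔⁴ K L M N h
        in *-close (seq x n) (seq y n) (seq x′ n) (seq y′ n) B C B>0 C>0 δB ηC
             (∣y∣≤B n L≤n) (∣x′∣≤C n K≤n) (p n M≤n) (q n N≤n)

    -ℝ-cong : ∀ {x y} → x ≃ y → -ℝ x ≃ -ℝ y
    -ℝ-cong {x} {y} (mk≃ f) = mk≃ λ ε ε>0 → let N , p = f ε ε>0 in
      N , λ n h → -‿close (seq x n) (seq y n) (p n h)

    +ℝ-assoc : ∀ x y z → (x +ℝ y) +ℝ z ≃ x +ℝ (y +ℝ z)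
    +ℝ-assoc x y z = pointwise λ n → ℚ.+-assoc (seq x n) (seq y n) (seq z n)

    +ℝ-comm : ∀ x y → x +ℝ y ≃ y +ℝ x
    +ℝ-comm x y = pointwise λ n → ℚ.+-comm (seq x n) (seq y n)

    +ℝ-identityˡ : ∀ x → fromℚ 0ℚ +ℝ x ≃ x
    +ℝ-identityˡ x = pointwise λ n → ℚ.+-identityˡ (seq x n)

    +ℝ-identityʳ : ∀ x → x +ℝ fromℚ 0ℚ ≃ x
    +ℝ-identityʳ x = pointwise λ n → ℚ.+-identityʳ (seq x n)

    -ℝ-inverseˡ : ∀ x → (-ℝ x) +ℝ x ≃ fromℚ 0ℚ
    -ℝ-inverseˡ x = pointwise λ n → ℚ.+-inverseˡ (seq x n)

    -ℝ-inverseʳ : ∀ x → x +ℝ (-ℝ x) ≃ fromℚ 0ℚ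
    -ℝ-inverseʳ x = pointwise λ n → ℚ.+-inverseʳ (seq x n)

    *ℝ-assoc : ∀ x y z → (x *ℝ y) *ℝ z ≃ x *ℝ (y *ℝ z)
    *ℝ-assoc x y z = pointwise λ n → ℚ.*-assoc (seq x n) (seq y n) (seq z n)

    *ℝ-comm : ∀ x y → x *ℝ y ≃ y *ℝ x
    *ℝ-comm x y = pointwise λ n → ℚ.*-comm (seq x n) (seq y n)

    *ℝ-identityˡ : ∀ x → fromℚ 1ℚ *ℝ x ≃ x
    *ℝ-identityˡ x = pointwise λ n → ℚ.*-identityˡ (seq x n)

    *ℝ-identityʳ : ∀ x → x *ℝ fromℚ 1ℚ ≃ x
    *ℝ-identityʳ x = pointwise λ n → ℚ.*-identityʳ (seq x n)

    *ℝ-distribˡ-+ℝ : ∀ x y z → x *ℝ (y +ℝ z) ≃ x *ℝ y +ℝ x *ℝ z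
    *ℝ-distribˡ-+ℝ x y z = pointwise λ n → ℚ.*-distribˡ-+ (seq x n) (seq y n) (seq z n)

    *ℝ-distribʳ-+ℝ : ∀ x y z → (y +ℝ z) *ℝ x ≃ y *ℝ x +ℝ z *ℝ x
    *ℝ-distribʳ-+ℝ x y z = pointwise λ n → ℚ.*-distribʳ-+ (seq x n) (seq y n) (seq z n)

    ≃-refl : ∀ {x} → x ≃ x
    ≃-refl = pointwise λ _ → refl

    ≃-isEquivalence : IsEquivalence _≃_
    ≃-isEquivalence = record { refl = ≃-refl ; sym = ≃-sym ; trans = ≃-trans }

    +ℝ-isMagma : IsMagma _≃_ _+ℝ_
    +ℝ-isMagma = record { isEquivalence = ≃-isEquivalence ; ∙-cong = +ℝ-cong }

    +ℝ-isMonoid : IsMonoid _≃_ _+ℝ_ (fromℚ 0ℚ)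
    +ℝ-isMonoid = record
      { isSemigroup = record { isMagma = +ℝ-isMagma ; assoc = +ℝ-assoc }
      ; identity    = +ℝ-identityˡ , +ℝ-identityʳ
      }

    +ℝ-isAbelianGroup : IsAbelianGroup _≃_ _+ℝ_ (fromℚ 0ℚ) -ℝ_
    +ℝ-isAbelianGroup = record
      { isGroup = record
        { isMonoid = +ℝ-isMonoid
        ; inverse  = -ℝ-inverseˡ , -ℝ-inverseʳ
        ; ⁻¹-cong  = -ℝ-cong
        }
      ; comm = +ℝ-comm
      }

    ℝ-isRing : IsRing _≃_ _+ℝ_ _*ℝ_ -ℝ_ (fromℚ 0ℚ) (fromℚ 1ℚ)
    ℝ-isRing = record
      { +-isAbelianGroup = +ℝ-isAbelianGroup
      ; *-cong     = *ℝ-cong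
      ; *-assoc    = *ℝ-assoc
      ; *-identity = *ℝ-identityˡ , *ℝ-identityʳ
      ; distrib    = *ℝ-distribˡ-+ℝ , *ℝ-distribʳ-+ℝ
      }

abstract
  ℝ-isCommutativeRing : IsCommutativeRing _≃_ _+ℝ_ _*ℝ_ -ℝ_ (fromℚ 0ℚ) (fromℚ 1ℚ)
  ℝ-isCommutativeRing = record { isRing = ℝ-isRing ; *-comm = *ℝ-comm }

ℝ-commutativeRing : CommutativeRing 0ℓ 0ℓ
ℝ-commutativeRing = record { isCommutativeRing = ℝ-isCommutativeRing }

module PowerSeries {c ℓ} (R : CommutativeRing c ℓ) where

  private
    module R = CommutativeRing R
    module R⁺ = RawSemiringDefinitions (Semiring.rawSemiring R.semiring)

    constant : R.Carrier → ℕ → R.Carrier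
    constant r zero    = r
    constant r (suc _) = R.0#

  -- A series is its sequence of coefficients; equality is coefficientwise.
  rawRing : RawRing c ℓ
  rawRing = record
    { Carrier = ℕ → R.Carrier
    ; _≈_     = λ f g → ∀ n → f n R.≈ g n
    ; _+_     = λ f g n → f n R.+ g n
    ; _*_     = λ f g n → R⁺.sum {suc n} λ i → f (toℕ i) R.* g (n ∸ toℕ i)
    ; -_      = λ f n → R.- f n
    ; 0#      = constant R.0#
    ; 1#      = constant R.1#
    }

  open RawRing rawRing public
  -- n · f is the n-fold sum f + … + f.
  open RawSemiringDefinitions rawSemiring public using (_^_) renaming (_×_ to _·_)

  x : Carrier
  x 1 = R.1#
  x _ = R.0#

  ∑ : ∀ {a} {A : Set a} → List A → (A → Carrier) → Carrier
  ∑ is f = foldr _+_ 0# (map f is)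

  -- Σₙ (u n) xⁿ
  generatingFunction : (ℕ → ℕ) → Carrier
  generatingFunction u n = u n R⁺.× R.1#

module ℝ⟦x⟧ = PowerSeries ℝ-commutativeRing

-- The alphabet [p] is Fin p, and positions 1, …, n are Fin n; the i-th
-- letter of Fin p (counting from 0) stands for the integer i + 1.

val : ∀ {p} → Fin p → ℤ
val a = + suc (toℕ a)

Word : ℕ → ℕ → Set
Word p n = Fin n → Fin p

-- h, i, j range over the triples of consecutive positions.
LocallyConvex : ∀ {p n} → ℕ → Word p n → Set
LocallyConvex {p} {n} k f = ∀ (h i j : Fin n) →
  toℕ i ≡ suc (toℕ h) → toℕ j ≡ suc (toℕ i) →
  val (f h) ℤ.+ val (f j) ℤ.- + 2 ℤ.* val (f i) ℤ.≤ + k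

locallyConvex? : ∀ {p n} k → Decidable (LocallyConvex {p} {n} k)
locallyConvex? k f = Fin.all? λ h → Fin.all? λ i → Fin.all? λ j →
  (toℕ i ℕ.≟ suc (toℕ h)) →-dec (toℕ j ℕ.≟ suc (toℕ i)) →-dec
  (val (f h) ℤ.+ val (f j) ℤ.- + 2 ℤ.* val (f i) ℤ.≤? + k)

-- finToFun : Fin (p ^ n) → Word p n is a bijection up to pointwise
-- equality of words, so every word is listed exactly once.
allWords : ∀ p n → List (Word p n)
allWords p n = map finToFun (allFin (p ℕ.^ n))

#words : (k p n : ℕ) → ℕ
#words k p n = length (filter (locallyConvex? k) (allWords p n))

LocallyConvexFrom : ∀ {p n} → ℕ → Fin p → Fin p → Word p (suc (suc n)) → Set
LocallyConvexFrom k a b f = LocallyConvex k f × f zero ≡ a × f (suc zero) ≡ b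

locallyConvexFrom? : ∀ {p n} k a b → Decidable (LocallyConvexFrom {p} {n} k a b)
locallyConvexFrom? k a b f =
  locallyConvex? k f ×-dec (f zero Fin.≟ a) ×-dec (f (suc zero) Fin.≟ b)

-- fₙ(a,b), with the value 0 for n < 2, where it is not defined; this makes
-- the sum over n ≥ 2 an ordinary generating function.
#wordsFrom : (k p n : ℕ) → Fin p → Fin p → ℕ
#wordsFrom k p 0 a b = 0
#wordsFrom k p 1 a b = 0
#wordsFrom k p n@(suc (suc _)) a b =
  length (filter (locallyConvexFrom? k a b) (allWords p n))

Unknowns : ℕ → Set
Unknowns p = Fin p → Fin p → ℝ⟦x⟧.Carrier

infix 4 _≋_

_≋_ : ∀ {p} → Unknowns p → Unknowns p → Set
F ≋ F′ = ∀ a b → F a b ℝ⟦x⟧.≈ F′ a b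

-- The letters i with i ≤ k + 2b - a.
successors : ∀ {p} → ℕ → Fin p → Fin p → List (Fin p)
successors {p} k a b =
  filter (λ i → val i ℤ.≤? + k ℤ.+ + 2 ℤ.* val b ℤ.- val a) (allFin p)

IsSolution : ∀ {p} → ℕ → Unknowns p → Set
IsSolution k F = ∀ a b → F a b ≈ x * ∑ (successors k a b) (λ i → F b i) + x ^ 2
  where open ℝ⟦x⟧

-- Σ_{n≥2} fₙ(a,b) xⁿ
wordSeries : (k p : ℕ) → Unknowns p
wordSeries k p a b = ℝ⟦x⟧.generatingFunction λ n → #wordsFrom k p n a b

G : (k p : ℕ) → ℝ⟦x⟧.Carrier
G k p = ℝ⟦x⟧.generatingFunction (#words k p)

{-# OPTIONS --safe #-}

-- Multiplication by x shifts coefficients, so the system determines the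
-- coefficients of F one after the other; this gives uniqueness. The numbers
-- fₙ(a,b) obey the same recurrence: removing the first letter of a locally
-- convex word a b i … leaves a locally convex word b i …, and the only
-- condition lost is i ≤ k + 2b - a.
module Submission where

open import Defs
open import Algebra.Bundles using (CommutativeRing)
import Algebra.Properties.CommutativeMonoid.Sum as CommutativeMonoidSum
import Algebra.Properties.Monoid.Mult as Mult
import Algebra.Properties.Monoid.Sum as MonoidSum
open import Data.Bool.Base using (true; false; if_then_else_)
open import Data.Fin.Base using (Fin; zero; suc; toℕ; _↑ˡ_; _↑ʳ_; combine; finToFun; remQuot)
open import Data.Fin.Properties using (_≟_; toℕ<n; remQuot-combine)
import Data.Integer.Base as ℤ
import Data.Integer.Properties as ℤ
open import Data.Integer.Solver using (module +-*-Solver)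
open import Data.List.Base using (List; []; _∷_; _++_; allFin; filter; length; tabulate)
open import Data.List.Properties
  using (filter-++; filter-all; filter-none; filter-≐; length-++; length-map; length-tabulate; map-tabulate)
open import Data.List.Relation.Unary.All using (universal)
open import Data.List.Relation.Unary.All.Properties using (tabulate⁺)
open import Data.Nat.Base as ℕ using (ℕ; zero; suc; _≤_; _≥_; z≤n; s≤s)
open import Data.Nat.Properties
  using (+-0-commutativeMonoid; +-identityʳ; ^-identityʳ; <⇒≱; ≤-trans; ≤-reflexive; ≤-refl)
open import Data.Product using (_×_; _,_; proj₁; proj₂; ∃!)
open import Data.Unit.Base using (tt)
open import Function.Base using (id; _∘_)
open import Function.Bundles using (_⇔_; mk⇔; module Equivalence)
open import Level using (Level)
open import Relation.Binary.PropositionalEquality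
  using (_≡_; _≢_; refl; sym; trans; cong; cong₂; subst; subst₂; module ≡-Reasoning)
open import Relation.Nullary using (Dec; ¬_; yes; no; contradiction; does)
open import Relation.Nullary.Decidable using (_×-dec_; does-⇔; dec-false)
open import Relation.Unary using (Pred; Decidable; _≐_)
open import Relation.Unary.Properties using (U?)

open CommutativeMonoidSum +-0-commutativeMonoid
  using (sum; sum-cong-≗; sum-replicate-zero; ∑-distrib-+)

private
  variable
    ℓ ℓ′ : Level
    A : Set ℓ
    P : Pred A ℓ
    k n p : ℕ

-- Counting

count : {P : Pred A ℓ} → Decidable P → List A → ℕ
count P? xs = length (filter P? xs)

indicator : Dec A → ℕ
indicator a? = if does a? then 1 else 0

indicator-⇔ : {B : Set ℓ′} → A ⇔ B → (a? : Dec A) (b? : Dec B) → indicator a? ≡ indicator b?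
indicator-⇔ A⇔B a? b? = cong (if_then 1 else 0) (does-⇔ A⇔B a? b?)

indicator-¬ : ¬ A → (a? : Dec A) → indicator a? ≡ 0
indicator-¬ ¬a a? = cong (if_then 1 else 0) (dec-false a? ¬a)

sum-δ : (u : Fin n → ℕ) (a : Fin n) → (∀ c → c ≢ a → u c ≡ 0) → sum u ≡ u a
sum-δ {suc n} u zero off = trans
  (cong (u zero ℕ.+_) (trans (sum-cong-≗ (λ c → off (suc c) λ ())) (sum-replicate-zero n)))
  (+-identityʳ (u zero))
sum-δ u (suc a) off = trans
  (cong (ℕ._+ sum (u ∘ suc)) (off zero λ ()))
  (sum-δ (u ∘ suc) a (λ c c≢a → off (suc c) λ { refl → c≢a refl }))

count-∷ : (P? : Decidable {A = A} P) → ∀ x xs → count P? (x ∷ xs) ≡ indicator (P? x) ℕ.+ count P? xs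
count-∷ P? x xs with does (P? x)
... | true  = refl
... | false = refl

module _ (P? : Decidable {A = A} P) where

  count-++ : ∀ xs ys → count P? (xs ++ ys) ≡ count P? xs ℕ.+ count P? ys
  count-++ xs ys = trans (cong length (filter-++ P? xs ys)) (length-++ (filter P? xs))

  -- Each entry `x` has exactly one value `h x`, so among the indicators of `P x × h x ≡ c`, with
  -- `c` varying, only the one at `c = h x` can be nonzero, and there it equals the indicator of
  -- `P x`. The rest is induction on the list.
  count-partition : (h : A → Fin p) → ∀ xs →
    count P? xs ≡ sum (λ c → count (λ x → P? x ×-dec (h x ≟ c)) xs)
  count-partition {p} h []       = sym (sum-replicate-zero p)
  count-partition {p} h (x ∷ xs) = begin
    count P? (x ∷ xs)                            ≡⟨ count-∷ P? x xs ⟩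
    indicator (P? x) ℕ.+ count P? xs             ≡⟨ cong₂ ℕ._+_ indicator-partition (count-partition h xs) ⟩
    sum now ℕ.+ sum later                        ≡⟨ ∑-distrib-+ now later ⟨
    sum (λ c → now c ℕ.+ later c)                ≡⟨ sum-cong-≗ (λ c → count-∷ (P×h≟ c) x xs) ⟨
    sum (λ c → count (P×h≟ c) (x ∷ xs))          ∎
    where
    open ≡-Reasoning
    P×h≟ : ∀ c → Decidable (λ x → P x × h x ≡ c)
    P×h≟ c x = P? x ×-dec (h x ≟ c)
    now later : Fin p → ℕ
    now   c = indicator (P×h≟ c x)
    later c = count (P×h≟ c) xs
    indicator-partition : indicator (P? x) ≡ sum now
    indicator-partition = sym (trans
      (sum-δ now (h x) λ c c≢hx → indicator-¬ (λ (_ , hx≡c) → c≢hx (sym hx≡c)) (P×h≟ c x))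
      (indicator-⇔ (mk⇔ proj₁ (_, refl)) (P×h≟ (h x) x) (P? x)))

  -- The entries of the two lists may have different types and are matched by their index alone.
  -- This allows words of length `suc n` to be compared with their tails.
  count-tabulate-⇔ : {B : Set ℓ} {Q : Pred B ℓ′} (Q? : Decidable Q) {f : Fin n → A} {g : Fin n → B} →
    (∀ i → P (f i) ⇔ Q (g i)) → count P? (tabulate f) ≡ count Q? (tabulate g)
  count-tabulate-⇔ {n = zero}  Q? P⇔Q = refl
  count-tabulate-⇔ {n = suc n} Q? {f} {g} P⇔Q
    with does (P? (f zero)) | does (Q? (g zero)) | does-⇔ (P⇔Q zero) (P? (f zero)) (Q? (g zero))
  ... | true  | _ | refl = cong suc (count-tabulate-⇔ Q? (P⇔Q ∘ suc))
  ... | false | _ | refl = count-tabulate-⇔ Q? (P⇔Q ∘ suc)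

  -- `combine i j` enumerates `Fin (m * n)` in consecutive blocks of length `n`. The block of
  -- `i = zero` is split off with `_↑ˡ_`, and `_↑ʳ_` shifts past it to the remaining blocks.
  count-tabulate-combine : ∀ m n (f : Fin (m ℕ.* n) → A) →
    count P? (tabulate f) ≡ sum (λ i → count P? (tabulate (f ∘ combine {m} {n} i)))
  count-tabulate-combine zero    n f = refl
  count-tabulate-combine (suc m) n f = begin
    count P? (tabulate f)                                         ≡⟨ cong (count P?) (tabulate-++ n f) ⟩
    count P? (tabulate first ++ tabulate rest)                    ≡⟨ count-++ (tabulate first) (tabulate rest) ⟩
    count P? (tabulate first) ℕ.+ count P? (tabulate rest)        ≡⟨ cong (count P? (tabulate first) ℕ.+_)
                                                                     (count-tabulate-combine m n rest) ⟩
    sum (λ i → count P? (tabulate (f ∘ combine {suc m} {n} i)))   ∎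
    where
    open ≡-Reasoning
    first : Fin n → A
    first = f ∘ (_↑ˡ (m ℕ.* n))
    rest : Fin (m ℕ.* n) → A
    rest  = f ∘ (n ↑ʳ_)
    tabulate-++ : ∀ m {n} (f : Fin (m ℕ.+ n) → A) →
      tabulate f ≡ tabulate (f ∘ (_↑ˡ n)) ++ tabulate (f ∘ (m ↑ʳ_))
    tabulate-++ zero    f = refl
    tabulate-++ (suc m) f = cong (f zero ∷_) (tabulate-++ m (f ∘ suc))

-- Words

allWords-tabulate : ∀ p n → allWords p n ≡ tabulate finToFun
allWords-tabulate p n = map-tabulate id finToFun

-- `finToFun` reads an index as digits in base `p`, the leading digit being the first letter. The
-- list of words thus falls into one block per first letter; in the block of `a` the tails run once
-- through the words of length `n`.
count-head : {P : Pred (Word p (suc n)) ℓ} {Q : Pred (Word p n) ℓ′} (P? : Decidable P) (Q? : Decidable Q) →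
  ∀ a → (∀ f → P f ⇔ (f zero ≡ a × Q (f ∘ suc))) →
  count P? (allWords p (suc n)) ≡ count Q? (allWords p n)
count-head {p} {n} {P = P} {Q = Q} P? Q? a P⇔ = begin
  count P? (allWords p (suc n))                 ≡⟨ cong (count P?) (allWords-tabulate p (suc n)) ⟩
  count P? (tabulate finToFun)                  ≡⟨ count-tabulate-combine P? p (p ℕ.^ n) finToFun ⟩
  -- A block whose first letter differs from `a` contains no word satisfying `P`.
  sum (λ c → count P? (tabulate (word c)))      ≡⟨ sum-δ _ a (λ c c≢a → cong length
                                                     (filter-none P? (tabulate⁺ (λ j → c≢a ∘ head≡a c j)))) ⟩
  count P? (tabulate (word a))                  ≡⟨ count-tabulate-⇔ P? Q? (λ j → mk⇔ (to j) (from j)) ⟩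
  count Q? (tabulate finToFun)                  ≡⟨ cong (count Q?) (allWords-tabulate p n) ⟨
  count Q? (allWords p n)                       ∎
  where
  open ≡-Reasoning
  word : Fin p → Fin (p ℕ.^ n) → Word p (suc n)
  word c j = finToFun (combine c j)
  head-word : ∀ c j → word c j zero ≡ c
  head-word c j = cong proj₁ (remQuot-combine c j)
  -- The tail of a decoded word is itself `finToFun` of the remainder, so congruence gives an
  -- equality of functions without extensionality, and `Q` can be transported along it.
  tail-word : ∀ c j → word c j ∘ suc ≡ finToFun j
  tail-word c j = cong (finToFun ∘ proj₂) (remQuot-combine {p} c j)
  head≡a : ∀ c j → P (word c j) → c ≡ a
  head≡a c j Pw = trans (sym (head-word c j)) (proj₁ (Equivalence.to (P⇔ _) Pw))
  to : ∀ j → P (word a j) → Q (finToFun j)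
  to j Pw = subst Q (tail-word a j) (proj₂ (Equivalence.to (P⇔ _) Pw))
  from : ∀ j → Q (finToFun j) → P (word a j)
  from j Qv = Equivalence.from (P⇔ _) (head-word a j , subst Q (sym (tail-word a j)) Qv)

-- The last of three consecutive positions has index at least 2, which must be less than `n`.
locallyConvex-short : n ≤ 2 → (f : Word p n) → LocallyConvex k f
locallyConvex-short n≤2 f h i j i≡1+h j≡1+i = contradiction
  (≤-trans n≤2 (≤-trans (s≤s (≤-trans (s≤s z≤n) (≤-reflexive (sym i≡1+h)))) (≤-reflexive (sym j≡1+i))))
  (<⇒≱ (toℕ<n j))

Successor : ℕ → Fin p → Fin p → Fin p → Set
Successor k a b i = val i ℤ.≤ ℤ.+ k ℤ.+ ℤ.+ 2 ℤ.* val b ℤ.- val a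

-- Agrees definitionally with the test inside `successors`, so lemmas about `filter` apply to that
-- list directly.
successor? : ∀ k (a b : Fin p) → Decidable (Successor k a b)
successor? k a b i = val i ℤ.≤? ℤ.+ k ℤ.+ ℤ.+ 2 ℤ.* val b ℤ.- val a

-- The order on the integers is invariant under translation: add `2b - a` in one direction and
-- `a - 2b` in the other.
successor-⇔ : ∀ k (a b i : Fin p) →
  (val a ℤ.+ val i ℤ.- ℤ.+ 2 ℤ.* val b ℤ.≤ ℤ.+ k) ⇔ Successor k a b i
successor-⇔ k a b i = mk⇔
  (λ le → subst₂ ℤ._≤_
    (solve 3 (λ a b i → con (ℤ.+ 2) :* b :- a :+ (a :+ i :- con (ℤ.+ 2) :* b) := i) refl (val a) (val b) (val i))
    (solve 3 (λ a b k → con (ℤ.+ 2) :* b :- a :+ k := k :+ con (ℤ.+ 2) :* b :- a) refl (val a) (val b) (ℤ.+ k))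
    (ℤ.+-monoʳ-≤ (ℤ.+ 2 ℤ.* val b ℤ.- val a) le))
  (λ le → subst₂ ℤ._≤_
    (solve 3 (λ a b i → a :- con (ℤ.+ 2) :* b :+ i := a :+ i :- con (ℤ.+ 2) :* b) refl (val a) (val b) (val i))
    (solve 3 (λ a b k → a :- con (ℤ.+ 2) :* b :+ (k :+ con (ℤ.+ 2) :* b :- a) := k) refl (val a) (val b) (ℤ.+ k))
    (ℤ.+-monoʳ-≤ (val a ℤ.- ℤ.+ 2 ℤ.* val b) le))
  where open +-*-Solver

locallyConvex-tail : (f : Word p (suc n)) → LocallyConvex k f → LocallyConvex k (f ∘ suc)
locallyConvex-tail f convex h i j i≡1+h j≡1+i =
  convex (suc h) (suc i) (suc j) (cong suc i≡1+h) (cong suc j≡1+i)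

-- The triple of positions 0, 1, 2 is the only one that does not lie in the tail.
locallyConvex-cons : (f : Word p (suc (suc (suc n)))) → LocallyConvex k (f ∘ suc) →
  Successor k (f zero) (f (suc zero)) (f (suc (suc zero))) → LocallyConvex k f
locallyConvex-cons f convex step zero (suc zero) (suc (suc zero)) refl refl =
  Equivalence.from (successor-⇔ _ (f zero) (f (suc zero)) (f (suc (suc zero)))) step
locallyConvex-cons f convex step (suc h) (suc i) (suc j) i≡1+h j≡1+i =
  convex h i j (cong ℕ.pred i≡1+h) (cong ℕ.pred j≡1+i)

-- Numbers of words and their recurrence

#words-short : ∀ k p → n ≤ 2 → #words k p n ≡ p ℕ.^ n
#words-short {n} k p n≤2 = begin
  #words k p n                 ≡⟨ cong length (filter-all (locallyConvex? k)
                                    (universal (locallyConvex-short n≤2) (allWords p n))) ⟩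
  length (allWords p n)        ≡⟨ length-map (finToFun {p} {n}) (allFin (p ℕ.^ n)) ⟩
  length (allFin (p ℕ.^ n))    ≡⟨ length-tabulate {n = p ℕ.^ n} id ⟩
  p ℕ.^ n                      ∎
  where open ≡-Reasoning

#words-sum : ∀ k p n →
  #words k p (suc (suc n)) ≡ sum (λ a → sum (λ b → #wordsFrom k p (suc (suc n)) a b))
#words-sum k p n = begin
  #words k p (suc (suc n))
    ≡⟨ count-partition convex? first words ⟩
  sum (λ a → count (convexFrom? a) words)
    ≡⟨ sum-cong-≗ (λ a → count-partition (convexFrom? a) second words) ⟩
  sum (λ a → sum (λ b → count (λ f → convexFrom? a f ×-dec (second f ≟ b)) words))
    ≡⟨ sum-cong-≗ (λ a → sum-cong-≗ (λ b → cong length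
         (filter-≐ (λ f → convexFrom? a f ×-dec (second f ≟ b)) (locallyConvexFrom? k a b) reassoc words))) ⟩
  sum (λ a → sum (λ b → #wordsFrom k p (suc (suc n)) a b))
    ∎
  where
  open ≡-Reasoning
  words = allWords p (suc (suc n))
  convex? = locallyConvex? {p} {suc (suc n)} k
  first second : Word p (suc (suc n)) → Fin p
  first  f = f zero
  second f = f (suc zero)
  convexFrom? : ∀ a → Decidable (λ f → LocallyConvex k f × first f ≡ a)
  convexFrom? a f = convex? f ×-dec (first f ≟ a)
  reassoc : ∀ {a b} → (λ f → (LocallyConvex k f × first f ≡ a) × second f ≡ b) ≐ LocallyConvexFrom k a b
  reassoc = (λ ((c , f0) , f1) → c , f0 , f1) , (λ (c , f0 , f1) → (c , f0) , f1)

-- Convexity is vacuous at length 2. Removing the two prescribed letters leaves the empty word,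
-- which is listed once.
#wordsFrom-2 : ∀ k (a b : Fin p) → #wordsFrom k p 2 a b ≡ 1
#wordsFrom-2 {p} k a b = trans
  (count-head (locallyConvexFrom? k a b) (λ f → f zero ≟ b) a
    (λ f → mk⇔ proj₂ (λ f0f1 → locallyConvex-short ≤-refl f , f0f1)))
  (count-head (λ f → f zero ≟ b) (U? {A = Word p 0}) b (λ f → mk⇔ (_, tt) proj₁))

-- The indicator replaces the restriction of the sum to `successors k a b`, so that the recurrence
-- can be summed over the whole alphabet.
#wordsAfter : (k p n : ℕ) → Fin p → Fin p → Fin p → ℕ
#wordsAfter k p n a b i = indicator (successor? k a b i) ℕ.* #wordsFrom k p n b i

#wordsFrom-suc : ∀ k (a b : Fin p) n →
  #wordsFrom k p (suc (suc (suc n))) a b ≡ sum (#wordsAfter k p (suc (suc n)) a b)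
#wordsFrom-suc {p} k a b n = begin
  #wordsFrom k p (suc (suc (suc n))) a b
    ≡⟨ count-head (locallyConvexFrom? k a b) extends? a (λ f → mk⇔
         (λ { (convex , refl , refl) → refl , (locallyConvex-tail f convex , refl) ,
                Equivalence.to (successor-⇔ k _ _ _) (convex zero (suc zero) (suc (suc zero)) refl refl) })
         (λ { (refl , (convex , refl) , step) → locallyConvex-cons f convex step , refl , refl })) ⟩
  count extends? words
    -- With `a` removed, the letter at `suc zero` is the third letter of the original word.
    ≡⟨ count-partition extends? (λ f → f (suc zero)) words ⟩
  sum (λ i → count (λ f → extends? f ×-dec (f (suc zero) ≟ i)) words)
    ≡⟨ sum-cong-≗ after ⟩
  sum (#wordsAfter k p (suc (suc n)) a b)
    ∎
  where
  open ≡-Reasoning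
  words = allWords p (suc (suc n))
  extends? : Decidable (λ (f : Word p (suc (suc n))) →
    (LocallyConvex k f × f zero ≡ b) × Successor k a b (f (suc zero)))
  extends? f = (locallyConvex? k f ×-dec (f zero ≟ b)) ×-dec successor? k a b (f (suc zero))
  after : ∀ i → count (λ f → extends? f ×-dec (f (suc zero) ≟ i)) words
              ≡ #wordsAfter k p (suc (suc n)) a b i
  after i with successor? k a b i
  -- Here the factor is 1, and `1 * w` reduces to `w + 0`.
  ... | yes s = trans
    (cong length (filter-≐ (λ f → extends? f ×-dec (f (suc zero) ≟ i)) (locallyConvexFrom? k b i)
      ( (λ (((convex , f0) , _) , f1) → convex , f0 , f1)
      , (λ { (convex , f0 , refl) → ((convex , f0) , s) , refl })) words))
    (sym (+-identityʳ _))
  ... | no ¬s = cong length (filter-none (λ f → extends? f ×-dec (f (suc zero) ≟ i))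
    (universal (λ { f ((_ , s) , refl) → ¬s s }) words))

-- Coefficients of power series

module Coefficients {c ℓ} (R : CommutativeRing c ℓ) where

  private
    module X = PowerSeries R
    module R where
      open CommutativeRing R public
      open Mult +-monoid public
      open MonoidSum +-monoid public
  open import Relation.Binary.Reasoning.Setoid R.setoid

  x*-zero : ∀ f → (X.x X.* f) 0 R.≈ R.0#
  x*-zero f = R.trans (R.+-identityʳ _) (R.zeroˡ _)

  -- In the convolution only the term of index 1 survives, since every other coefficient of `x` is
  -- zero.
  x*-suc : ∀ f n → (X.x X.* f) (suc n) R.≈ f n
  x*-suc f n = begin
    R.0# R.* f (suc n) R.+ (R.1# R.* f n R.+ R.sum tail)  ≈⟨ R.+-cong (R.zeroˡ _) (R.+-cong (R.*-identityˡ _) tail≈0) ⟩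
    R.0# R.+ (f n R.+ R.0#)                               ≈⟨ R.+-identityˡ _ ⟩
    f n R.+ R.0#                                          ≈⟨ R.+-identityʳ _ ⟩
    f n                                                   ∎
    where
    tail : Fin n → R.Carrier
    tail i = X.x (suc (suc (toℕ i))) R.* f (suc n ℕ.∸ suc (suc (toℕ i)))
    tail≈0 : R.sum tail R.≈ R.0#
    tail≈0 = R.trans (R.sum-cong-≋ {n} {tail} {λ _ → R.0#} (λ i → R.zeroˡ _)) (R.sum-replicate-zero n)

  x*+x²-zero : ∀ f → (X.x X.* f X.+ X.x X.^ 2) 0 R.≈ R.0#
  x*+x²-zero f = R.trans (R.+-cong (x*-zero f) (x*-zero (X.x X.* X.1#))) (R.+-identityˡ R.0#)

  x²-1 : (X.x X.^ 2) 1 R.≈ R.0#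
  x²-1 = R.trans (x*-suc (X.x X.* X.1#) 0) (x*-zero X.1#)

  x²-suc-suc : ∀ n → (X.x X.^ 2) (suc (suc n)) R.≈ X.1# n
  x²-suc-suc n = R.trans (x*-suc (X.x X.* X.1#) (suc n)) (x*-suc X.1# n)

  ·-coefficient : ∀ m f n → (m X.· f) n R.≈ m R.× f n
  -- The zero series is defined by cases on the exponent, so its coefficients reduce only after a
  -- split on `n`.
  ·-coefficient zero    f zero    = R.refl
  ·-coefficient zero    f (suc n) = R.refl
  ·-coefficient (suc m) f n       = R.+-congˡ (·-coefficient m f n)

  ×-zeroʳ : ∀ m → m R.× R.0# R.≈ R.0#
  ×-zeroʳ zero    = R.refl
  ×-zeroʳ (suc m) = R.trans (R.+-identityˡ _) (×-zeroʳ m)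

  module _ {a} {A : Set a} where

    ∑-cong : ∀ (is : List A) {f g} n → (∀ i → f i n R.≈ g i n) → X.∑ is f n R.≈ X.∑ is g n
    ∑-cong []       n f≈g = R.refl
    ∑-cong (i ∷ is) n f≈g = R.+-cong (f≈g i) (∑-cong is n f≈g)

    -- Links the two forms of a restricted sum: a filtered list on the side of the series, indicator
    -- weights on the side of the counting recurrence.
    ∑-filter : ∀ {p} {P : Pred A p} (P? : Decidable P) {m} (g : Fin m → A) f n (u : A → ℕ) →
      (∀ i → f i n R.≈ u i R.× R.1#) →
      X.∑ (filter P? (tabulate g)) f n R.≈ sum (λ i → indicator (P? (g i)) ℕ.* u (g i)) R.× R.1#
    ∑-filter P? {zero}  g f zero    u f≈u = R.refl
    ∑-filter P? {zero}  g f (suc n) u f≈u = R.refl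
    ∑-filter P? {suc m} g f n u f≈u with does (P? (g zero))
    ... | false = ∑-filter P? (g ∘ suc) f n u f≈u
    ... | true  = begin
      f (g zero) n R.+ X.∑ (filter P? (tabulate (g ∘ suc))) f n
        ≈⟨ R.+-cong (f≈u (g zero)) (∑-filter P? (g ∘ suc) f n u f≈u) ⟩
      u (g zero) R.× R.1# R.+ later R.× R.1#
        ≈⟨ R.×-homo-+ R.1# (u (g zero)) later ⟨
      (u (g zero) ℕ.+ later) R.× R.1#
        -- The weight `1 * u` of a retained entry reduces to `u + 0`.
        ≡⟨ cong (λ v → (v ℕ.+ later) R.× R.1#) (sym (+-identityʳ (u (g zero)))) ⟩
      (u (g zero) ℕ.+ 0 ℕ.+ later) R.× R.1#
        ∎
      where
      later : ℕ
      later = sum (λ i → indicator (P? (g (suc i))) ℕ.* u (g (suc i)))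

    ∑-tabulate : ∀ {m} (g : Fin m → A) f n (u : A → ℕ) → (∀ i → f i n R.≈ u i R.× R.1#) →
      X.∑ (tabulate g) f n R.≈ sum (u ∘ g) R.× R.1#
    ∑-tabulate {zero}  g f zero    u f≈u = R.refl
    ∑-tabulate {zero}  g f (suc n) u f≈u = R.refl
    ∑-tabulate {suc m} g f n u f≈u = R.trans
      (R.+-cong (f≈u (g zero)) (∑-tabulate (g ∘ suc) f n u f≈u))
      (R.sym (R.×-homo-+ R.1# (u (g zero)) (sum (u ∘ g ∘ suc))))

    ∑-zero : ∀ (is : List A) f n → (∀ i → f i n R.≈ R.0#) → X.∑ is f n R.≈ R.0#
    ∑-zero []       f zero    f≈0 = R.refl
    ∑-zero []       f (suc n) f≈0 = R.refl
    ∑-zero (i ∷ is) f n       f≈0 = R.trans (R.+-cong (f≈0 i) (∑-zero is f n f≈0)) (R.+-identityˡ R.0#)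

-- The linear system over the reals

private
  module R where
    open CommutativeRing ℝ-commutativeRing public
    open Mult +-monoid public

open Coefficients ℝ-commutativeRing

private
  module X = ℝ⟦x⟧

module _ (k : ℕ) where

  solution-zero : (F : Unknowns p) → IsSolution k F → ∀ a b → F a b 0 R.≈ R.0#
  solution-zero F isSol a b = R.trans (isSol a b 0) (x*+x²-zero (X.∑ (successors k a b) (F b)))

  solution-suc : (F : Unknowns p) → IsSolution k F → ∀ a b n →
    F a b (suc n) R.≈ X.∑ (successors k a b) (F b) n R.+ (X.x X.^ 2) (suc n)
  solution-suc F isSol a b n = R.trans (isSol a b (suc n))
    (R.+-congʳ (x*-suc (X.∑ (successors k a b) (F b)) n))

  -- Induction on the exponent, for all `a` and `b` at once: coefficient `suc n` of `F a b` involves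
  -- only coefficients `n` of the series `F b i`.
  solution-unique : (F F′ : Unknowns p) → IsSolution k F → IsSolution k F′ → F ≋ F′
  solution-unique F F′ isSol isSol′ a b zero =
    R.trans (solution-zero F isSol a b) (R.sym (solution-zero F′ isSol′ a b))
  solution-unique F F′ isSol isSol′ a b (suc n) = R.trans (solution-suc F isSol a b n) (R.trans
    (R.+-congʳ (∑-cong (successors k a b) n (λ i → solution-unique F F′ isSol isSol′ b i n)))
    (R.sym (solution-suc F′ isSol′ a b n)))

-- The counting recurrence starts at length 3, so lower coefficients are checked separately. At
-- exponent 1 both sides vanish. At exponent 2 the sum vanishes, by the convention that the counts
-- are 0 below length 2, and the term `x ^ 2` supplies the single word. From exponent 3 on `x ^ 2`
-- contributes nothing.
wordSeries-suc : ∀ k (a b : Fin p) n →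
  wordSeries k p a b (suc n) R.≈ X.∑ (successors k a b) (wordSeries k p b) n R.+ (X.x X.^ 2) (suc n)
wordSeries-suc {p} k a b 0 = R.sym (R.trans
  (R.+-cong (∑-zero (successors k a b) (wordSeries k p b) 0 (λ _ → R.refl)) x²-1) (R.+-identityˡ R.0#))
wordSeries-suc {p} k a b 1 = R.trans
  (R.trans (R.×-congˡ (#wordsFrom-2 k a b)) (R.×-homo-1 R.1#))
  (R.sym (R.trans
    (R.+-cong (∑-zero (successors k a b) (wordSeries k p b) 1 (λ _ → R.refl)) (x²-suc-suc 0)) (R.+-identityˡ R.1#)))
wordSeries-suc {p} k a b (suc (suc n)) = R.trans
  (R.×-congˡ (#wordsFrom-suc k a b n))
  (R.sym (R.trans
    (R.+-cong
      (∑-filter (successor? k a b) id (wordSeries k p b) (suc (suc n)) (#wordsFrom k p (suc (suc n)) b) (λ _ → R.refl))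
      (x²-suc-suc (suc n)))
    (R.+-identityʳ _)))

wordSeries-isSolution : ∀ k p → IsSolution k (wordSeries k p)
wordSeries-isSolution k p a b zero = R.sym (x*+x²-zero (X.∑ (successors k a b) (wordSeries k p b)))
wordSeries-isSolution k p a b (suc n) = R.trans (wordSeries-suc k a b n)
  (R.+-congʳ (R.sym (x*-suc (X.∑ (successors k a b) (wordSeries k p b)) n)))

-- The generating function of all words

∑∑ : Unknowns p → X.Carrier
∑∑ {p} F = X.∑ (allFin p) (λ a → X.∑ (allFin p) (λ b → F a b))

∑∑-zero : (F : Unknowns p) → ∀ n → (∀ a b → F a b n R.≈ R.0#) → ∑∑ F n R.≈ R.0#
∑∑-zero {p} F n F≈0 = ∑-zero (allFin p) _ n (λ a → ∑-zero (allFin p) (F a) n (F≈0 a))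

-- At exponents 0 and 1 the double sum vanishes, and `1#` and `p · x` account for the words, all of
-- which are locally convex. From exponent 2 on these two terms vanish, and the words are split by
-- their first two letters.
G-wordSeries : ∀ k p → G k p X.≈ X.1# X.+ p X.· X.x X.+ ∑∑ (wordSeries k p)
G-wordSeries k p 0 = begin
  #words k p 0 R.× R.1#                              ≈⟨ R.×-congˡ (#words-short k p z≤n) ⟩
  1 R.× R.1#                                         ≈⟨ R.+-cong R.refl (R.×-homo-0 R.1#) ⟩
  R.1# R.+ R.0#                                      ≈⟨ R.+-identityʳ _ ⟨
  R.1# R.+ R.0# R.+ R.0#                             ≈⟨ R.+-cong (R.+-congˡ (R.trans (·-coefficient p X.x 0) (×-zeroʳ p)))
                                                          (∑∑-zero (wordSeries k p) 0 (λ _ _ → R.refl)) ⟨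
  R.1# R.+ (p X.· X.x) 0 R.+ ∑∑ (wordSeries k p) 0   ∎
  where open import Relation.Binary.Reasoning.Setoid R.setoid
G-wordSeries k p 1 = begin
  #words k p 1 R.× R.1#                              ≈⟨ R.×-congˡ (trans (#words-short k p (s≤s z≤n)) (^-identityʳ p)) ⟩
  p R.× R.1#                                         ≈⟨ R.+-identityˡ _ ⟨
  R.0# R.+ p R.× R.1#                                ≈⟨ R.+-identityʳ _ ⟨
  R.0# R.+ p R.× R.1# R.+ R.0#                       ≈⟨ R.+-cong (R.+-congˡ (·-coefficient p X.x 1))
                                                          (∑∑-zero (wordSeries k p) 1 (λ _ _ → R.refl)) ⟨
  R.0# R.+ (p X.· X.x) 1 R.+ ∑∑ (wordSeries k p) 1   ∎
  where open import Relation.Binary.Reasoning.Setoid R.setoid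
G-wordSeries k p n@(suc (suc m)) = begin
  #words k p n R.× R.1#                              ≈⟨ R.×-congˡ (#words-sum k p m) ⟩
  sum (λ a → sum (#wordsFrom k p n a)) R.× R.1#      ≈⟨ ∑-tabulate id _ n (λ a → sum (#wordsFrom k p n a)) (λ a →
                                                          ∑-tabulate id (wordSeries k p a) n (#wordsFrom k p n a) (λ _ → R.refl)) ⟨
  ∑∑ (wordSeries k p) n                              ≈⟨ R.+-identityˡ _ ⟨
  R.0# R.+ ∑∑ (wordSeries k p) n                     ≈⟨ R.+-congʳ (R.+-identityˡ R.0#) ⟨
  R.0# R.+ R.0# R.+ ∑∑ (wordSeries k p) n            ≈⟨ R.+-congʳ (R.+-congˡ (R.trans (·-coefficient p X.x n) (×-zeroʳ p))) ⟨
  R.0# R.+ (p X.· X.x) n R.+ ∑∑ (wordSeries k p) n   ∎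
  where open import Relation.Binary.Reasoning.Setoid R.setoid

mainTheorem2 : (p k : ℕ) → p ≥ 1 →
    ∃! (_≋_ {p}) (IsSolution k) ×
    ((F : Unknowns p) → IsSolution k F →
    (F ≋ wordSeries k p) ×
    (let open ℝ⟦x⟧ in
    G k p ≈ 1# + p · x + ∑ (allFin p) (λ a → ∑ (allFin p) (λ b → F a b))))
mainTheorem2 p k _ =
  (S , S-isSolution , λ {F} → solution-unique k S F S-isSolution) ,
  λ F isSol →
    solution-unique k F S isSol S-isSolution ,
    -- The formula is known for `S`; uniqueness carries it over to `F`, coefficient by coefficient.
    λ n → R.trans (G-wordSeries k p n) (R.+-congˡ
      (∑-cong (allFin p) n λ a → ∑-cong (allFin p) n λ b → solution-unique k S F S-isSolution isSol a b n))
  where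
  S : Unknowns p
  S = wordSeries k p
  S-isSolution : IsSolution k S
  S-isSolution = wordSeries-isSolution k p
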